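{- Let $G$ be a finite group, $S\subseteq G$ a symmetric subset, $\alpha_0>0$, and let $\hat G=\{\rho_1,\dots,\rho_L\}$ be a maximal set of inequivalent irreducible (complex) representations of $G$, with $d_\rho$ the dimension of $\rho$. Let $M(\rho)=\sum_{g\in S}\rho(g)$, and for each $i$ let $v^i_j$ ($1\le j\le d_{\rho_i}$) be the $j$th eigenvector of $M(\rho_i)$, with eigenvalue $\nu^i_j$. Let $H^i_{jk}$ be the $d_{\rho_i}\times d_{\rho_i}$ zero matrix with its $k$th column replaced by $v^i_j$, and define the function $f^i_{jk}$ on $\hat G$, with $f^i_{jk}(\rho)$ a $d_\rho\times d_\rho$ complex matrix, by $$f^i_{jk}(\rho_i)=H^i_{jk},\qquad f^i_{jk}(\rho)=0\ \text{ for }\rho\in\hat G,\ \rho\ne\rho_i.$$ Then $f^i_{jk}$ is an eigenfunction of the operator $\hat H_0$ with corresponding eigenvalue $$\lambda^i_{jk}=|S|+\alpha_0-\nu^i_j$$ for all $i=1,\dots,L$ and $1\le j,k\le d_{\rho_i}$.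
   Context: $S$ symmetric means $g\in S\Rightarrow g^{ -1}\in S$. On the Cayley graph $X(G,S)$ (vertex set $G$, edges $(g,h)$ with $gh^{ -1}\in S$), the diffusion operator is $H_0[f]=\big((|S|+\alpha_0)\chi_e-\chi_S\big)*f$, where $\chi_e$ and $\chi_S$ are the characteristic functions of the identity element and of $S$, and $(f*h)(g)=\sum_{r\in G}f(r^{ -1})h(rg)$. The Fourier transform of $f:G\to\mathbb{C}$ is $\mathcal{F}[f](\rho)=\sum_{g\in G}f(g)\rho(g)$, a $d_\rho\times d_\rho$ matrix for each $\rho\in\hat G$ (each representation realized by matrices). The operator $\hat H_0$ is the Fourier transform of $H_0$; it acts on functions $F$ assigning to each $\rho\in\hat G$ a matrix $F(\rho)\in\mathbb{C}^{d_\rho\times d_\rho}$ by $$\hat H_0[F](\rho)=(|S|+\alpha_0)F(\rho)-\sum_{g\in S}\rho(g)F(\rho).$$ For each $i$ the matrix $M(\rho_i)$ is diagonalizable, and $v^i_1,\dots,v^i_{d_{\rho_i}}$ denotes a basis of its eigenvectors. -}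

module Defs where

open import Algebra.Bundles using (CommutativeRing; Group)
open import Algebra.Bundles.Raw using (RawMonoid)
open import Algebra.Morphism.Structures using (IsMonoidHomomorphism)
import Algebra.Properties.Ring as RingProperties
import Algebra.Properties.Semiring.Sum as SemiringSum
import Algebra.Solver.Ring.NaturalCoefficients.Default as NaturalSolver
open import Data.Fin.Base using (Fin)
import Data.Fin.Properties as Fin
open import Data.Integer.Base using (+_)
open import Data.List.Base as List using (List; filter; allFin; foldr)
open import Data.Nat.Base as ℕ using (ℕ)
import Data.Nat.Properties as ℕ
open import Data.Product.Base using (∃; ∃-syntax; _×_; _,_; proj₁; proj₂)
open import Data.Rational.Base as ℚ using (ℚ; 0ℚ; 1ℚ; ½; ∣_∣)
import Data.Rational.Properties as ℚ
open import Data.Rational.Solver using (module +-*-Solver)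
open import Data.Sum.Base using (_⊎_)
open import Data.Vec.Functional using (Vector; transpose; updateAt)
open import Function.Base using (const)
open import Function.Bundles using (Inverse)
open import Level using (Level; 0ℓ; _⊔_) renaming (suc to lsuc)
open import Relation.Binary.Core using (Rel)
open import Relation.Binary.Definitions using (_Respects_)
open import Relation.Binary.PropositionalEquality as ≡ using (_≡_; _≢_; refl; cong)
open import Relation.Nullary.Decidable using (yes; no)
open import Relation.Nullary.Negation using (¬_)
open import Relation.Unary using (Pred; Decidable)

private variable
  c ℓ p : Level
  m n k : ℕ

-- Identities behind the ring laws for complex numbers a + b i over R; the
-- solver handles semirings, so - x is rewritten as u * x with u = - 1.
private module ComplexLaws {c ℓ} (R : CommutativeRing c ℓ) where
  open CommutativeRing R renaming (refl to ≈refl)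
  open RingProperties ring using (-1*x≈-x)
  open NaturalSolver commutativeSemiring

  u : Carrier
  u = - 1#

  neg : ∀ x → - x ≈ u * x
  neg x = sym (-1*x≈-x x)

  re-neg : ∀ a b c d → a * c + - (b * d) ≈ a * c + u * (b * d)
  re-neg a b c d = +-congˡ (neg (b * d))

  assoc-re : ∀ a b c d e f →
    (a * c + - (b * d)) * e + - ((a * d + b * c) * f) ≈
    a * (c * e + - (d * f)) + - (b * (c * f + d * e))
  assoc-re a b c d e f =
    trans (+-cong (*-congʳ (re-neg a b c d)) (neg _))
    (trans (solve 7 (λ u a b c d e f →
      (a :* c :+ u :* (b :* d)) :* e :+ u :* ((a :* d :+ b :* c) :* f) :=
      a :* (c :* e :+ u :* (d :* f)) :+ u :* (b :* (c :* f :+ d :* e))) ≈refl u a b c d e f)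
    (sym (+-cong (*-congˡ (re-neg c d e f)) (neg _))))

  assoc-im : ∀ a b c d e f →
    (a * c + - (b * d)) * f + (a * d + b * c) * e ≈
    a * (c * f + d * e) + b * (c * e + - (d * f))
  assoc-im a b c d e f =
    trans (+-congʳ (*-congʳ (re-neg a b c d)))
    (trans (solve 7 (λ u a b c d e f →
      (a :* c :+ u :* (b :* d)) :* f :+ (a :* d :+ b :* c) :* e :=
      a :* (c :* f :+ d :* e) :+ b :* (c :* e :+ u :* (d :* f))) ≈refl u a b c d e f)
    (sym (+-congˡ (*-congˡ (re-neg c d e f)))))

  distrib-re : ∀ a b c d e f →
    a * (c + e) + - (b * (d + f)) ≈ (a * c + - (b * d)) + (a * e + - (b * f))
  distrib-re a b c d e f =
    trans (re-neg a b (c + e) (d + f))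
    (trans (solve 7 (λ u a b c d e f →
      a :* (c :+ e) :+ u :* (b :* (d :+ f)) :=
      (a :* c :+ u :* (b :* d)) :+ (a :* e :+ u :* (b :* f))) ≈refl u a b c d e f)
    (sym (+-cong (re-neg a b c d) (re-neg a b e f))))

  distrib-im : ∀ a b c d e f →
    a * (d + f) + b * (c + e) ≈ (a * d + b * c) + (a * f + b * e)
  distrib-im = solve 6 (λ a b c d e f →
    a :* (d :+ f) :+ b :* (c :+ e) := (a :* d :+ b :* c) :+ (a :* f :+ b :* e)) ≈refl

  comm-re : ∀ a b c d → a * c + - (b * d) ≈ c * a + - (d * b)
  comm-re a b c d = +-cong (*-comm a c) (-‿cong (*-comm b d))

  comm-im : ∀ a b c d → a * d + b * c ≈ c * b + d * a
  comm-im = solve 4 (λ a b c d → a :* d :+ b :* c := c :* b :+ d :* a) ≈refl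

  identity-re : ∀ a b → 1# * a + - (0# * b) ≈ a
  identity-re a b = trans (re-neg 1# 0# a b)
    (solve 3 (λ u a b → con 1 :* a :+ u :* (con 0 :* b) := a) ≈refl u a b)

  identity-im : ∀ a b → 1# * b + 0# * a ≈ b
  identity-im = solve 2 (λ a b → con 1 :* b :+ con 0 :* a := b) ≈refl

------------------------------------------------------------------------
-- Real numbers: Cauchy sequences of rationals, identified up to null
-- sequences. The moduli are part of the data, since ∃ is a Σ-type.

Eventually : Pred ℕ 0ℓ → Set
Eventually P = ∃[ N ] ∀ n → N ℕ.≤ n → P n

Cauchy : (ℕ → ℚ) → Set
Cauchy x = ∀ ε → 0ℚ ℚ.< ε →
           ∃[ N ] ∀ m n → N ℕ.≤ m → N ℕ.≤ n → ∣ x m ℚ.- x n ∣ ℚ.< ε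

record ℝ : Set where
  no-eta-equality
  field
    seq    : ℕ → ℚ
    cauchy : Cauchy seq
open ℝ public

infix 4 _≈ℝ_ _<ℝ_ _#ℝ_

record _≈ℝ_ (x y : ℝ) : Set where
  constructor mk≈
  field close : ∀ ε → 0ℚ ℚ.< ε →
                Eventually λ n → ∣ seq x n ℚ.- seq y n ∣ ℚ.< ε
open _≈ℝ_ public

_<ℝ_ : Rel ℝ 0ℓ
x <ℝ y = ∃[ ε ] (0ℚ ℚ.< ε) × Eventually λ n → seq x n ℚ.+ ε ℚ.< seq y n

-- Apartness: the positive form of inequality.
_#ℝ_ : Rel ℝ 0ℓ
x #ℝ y = (x <ℝ y) ⊎ (y <ℝ x)

private
  open +-*-Solver using (solve; _:+_; _:*_; _:-_; :-_; _:=_; con)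

  halve : ∀ {ε} → 0ℚ ℚ.< ε → 0ℚ ℚ.< ½ ℚ.* ε
  halve = ℚ.*-monoʳ-<-pos ½

  halves : ∀ ε → ½ ℚ.* ε ℚ.+ ½ ℚ.* ε ≡ ε
  halves ε = ≡.trans (≡.sym (ℚ.*-distribʳ-+ ε ½ ½)) (ℚ.*-identityˡ ε)

  infixl 4 _∧ᴱ_
  _∧ᴱ_ : ∀ {P Q : Pred ℕ 0ℓ} → Eventually P → Eventually Q → Eventually λ n → P n × Q n
  (M , p) ∧ᴱ (N , q) = M ℕ.⊔ N , λ n le →
    p n (ℕ.≤-trans (ℕ.m≤m⊔n M N) le) , q n (ℕ.≤-trans (ℕ.m≤n⊔m M N) le)

  mapᴱ : ∀ {P Q : Pred ℕ 0ℓ} → (∀ {n} → P n → Q n) → Eventually P → Eventually Q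
  mapᴱ f (N , p) = N , λ n le → f (p n le)

  ∣a-b∣-sym : ∀ a b → ∣ a ℚ.- b ∣ ≡ ∣ b ℚ.- a ∣
  ∣a-b∣-sym a b = ≡.trans (≡.sym (ℚ.∣-p∣≡∣p∣ (a ℚ.- b)))
    (cong ∣_∣ (solve 2 (λ a b → :- (a :- b) := b :- a) refl a b))

  +-bound : ∀ {a b c d ε} → ∣ a ℚ.- b ∣ ℚ.< ½ ℚ.* ε → ∣ c ℚ.- d ∣ ℚ.< ½ ℚ.* ε →
            ∣ (a ℚ.+ c) ℚ.- (b ℚ.+ d) ∣ ℚ.< ε
  +-bound {a} {b} {c} {d} {ε} p q = begin-strict
    ∣ (a ℚ.+ c) ℚ.- (b ℚ.+ d) ∣      ≡⟨ cong ∣_∣ (solve 4 (λ a b c d →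
                                         (a :+ c) :- (b :+ d) := (a :- b) :+ (c :- d))
                                         refl a b c d) ⟩
    ∣ (a ℚ.- b) ℚ.+ (c ℚ.- d) ∣      ≤⟨ ℚ.∣p+q∣≤∣p∣+∣q∣ (a ℚ.- b) (c ℚ.- d) ⟩
    ∣ a ℚ.- b ∣ ℚ.+ ∣ c ℚ.- d ∣      <⟨ ℚ.+-mono-< p q ⟩
    ½ ℚ.* ε ℚ.+ ½ ℚ.* ε              ≡⟨ halves ε ⟩
    ε                                ∎
    where open ℚ.≤-Reasoning

  neg-bound : ∀ {ε} a b → ∣ a ℚ.- b ∣ ℚ.< ε → ∣ ℚ.- a ℚ.- ℚ.- b ∣ ℚ.< ε
  neg-bound {ε} a b = ≡.subst (ℚ._< ε) (≡.trans (∣a-b∣-sym a b)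
    (cong ∣_∣ (solve 2 (λ a b → b :- a := :- a :- (:- b)) refl a b)))

  trans-bound : ∀ {a b c ε} → ∣ a ℚ.- b ∣ ℚ.< ½ ℚ.* ε → ∣ b ℚ.- c ∣ ℚ.< ½ ℚ.* ε →
                ∣ a ℚ.- c ∣ ℚ.< ε
  trans-bound {a} {b} {c} {ε} p q = ≡.subst (ℚ._< ε)
    (cong ∣_∣ (solve 3 (λ a b c → (a :+ b) :- (b :+ c) := a :- c) refl a b c))
    (+-bound {a} {b} {b} {c} p q)

  *-scale : ∀ {x y B δ} → ∣ x ∣ ℚ.< B → ∣ y ∣ ℚ.< δ → 0ℚ ℚ.< B → ∣ x ℚ.* y ∣ ℚ.≤ B ℚ.* δ
  *-scale {x} {y} {B} {δ} p q B>0 = begin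
    ∣ x ℚ.* y ∣       ≡⟨ ℚ.∣p*q∣≡∣p∣*∣q∣ x y ⟩
    ∣ x ∣ ℚ.* ∣ y ∣   ≤⟨ ℚ.*-monoʳ-≤-nonNeg ∣ y ∣ {{ℚ.nonNegative (ℚ.0≤∣p∣ y)}} (ℚ.<⇒≤ p) ⟩
    B ℚ.* ∣ y ∣       ≤⟨ ℚ.*-monoˡ-≤-nonNeg B {{ℚ.nonNegative (ℚ.<⇒≤ B>0)}} (ℚ.<⇒≤ q) ⟩
    B ℚ.* δ           ∎
    where open ℚ.≤-Reasoning

  *-bound : ∀ {a b c d A D δ} → 0ℚ ℚ.< A → 0ℚ ℚ.< D → ∣ a ∣ ℚ.< A → ∣ d ∣ ℚ.< D →
            ∣ a ℚ.- b ∣ ℚ.< δ → ∣ c ℚ.- d ∣ ℚ.< δ →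
            ∣ a ℚ.* c ℚ.- b ℚ.* d ∣ ℚ.≤ (A ℚ.+ D) ℚ.* δ
  *-bound {a} {b} {c} {d} {A} {D} {δ} A>0 D>0 a<A d<D p q = begin
    ∣ a ℚ.* c ℚ.- b ℚ.* d ∣
      ≡⟨ cong ∣_∣ (solve 4 (λ a b c d →
           a :* c :- b :* d := a :* (c :- d) :+ d :* (a :- b)) refl a b c d) ⟩
    ∣ a ℚ.* (c ℚ.- d) ℚ.+ d ℚ.* (a ℚ.- b) ∣
      ≤⟨ ℚ.∣p+q∣≤∣p∣+∣q∣ (a ℚ.* (c ℚ.- d)) (d ℚ.* (a ℚ.- b)) ⟩
    ∣ a ℚ.* (c ℚ.- d) ∣ ℚ.+ ∣ d ℚ.* (a ℚ.- b) ∣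
      ≤⟨ ℚ.+-mono-≤ (*-scale {a} a<A q A>0) (*-scale {d} d<D p D>0) ⟩
    A ℚ.* δ ℚ.+ D ℚ.* δ
      ≡⟨ ℚ.*-distribʳ-+ δ A D ⟨
    (A ℚ.+ D) ℚ.* δ ∎
    where open ℚ.≤-Reasoning

  split : ∀ B ε → 0ℚ ℚ.< B → 0ℚ ℚ.< ε → ∃[ δ ] (0ℚ ℚ.< δ) × (B ℚ.* δ ℚ.< ε)
  split B ε B>0 ε>0 = δ , δ>0 , Bδ<ε
    where
    instance
      B⁺ : ℚ.Positive B
      B⁺ = ℚ.positive B>0
      B≠0 : ℚ.NonZero B
      B≠0 = ℚ.pos⇒nonZero B

    δ : ℚ
    δ = ℚ.1/ B ℚ.* (½ ℚ.* ε)

    δ>0 : 0ℚ ℚ.< δ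
    δ>0 = ≡.subst (ℚ._< δ) (ℚ.*-zeroʳ (ℚ.1/ B))
            (ℚ.*-monoʳ-<-pos (ℚ.1/ B) {{ℚ.1/pos⇒pos B}} (halve ε>0))

    Bδ<ε : B ℚ.* δ ℚ.< ε
    Bδ<ε = begin-strict
      B ℚ.* (ℚ.1/ B ℚ.* (½ ℚ.* ε))   ≡⟨ ℚ.*-assoc B (ℚ.1/ B) (½ ℚ.* ε) ⟨
      (B ℚ.* ℚ.1/ B) ℚ.* (½ ℚ.* ε)   ≡⟨ cong (ℚ._* (½ ℚ.* ε)) (ℚ.*-inverseʳ B) ⟩
      1ℚ ℚ.* (½ ℚ.* ε)               ≡⟨ ℚ.*-identityˡ (½ ℚ.* ε) ⟩
      ½ ℚ.* ε                        ≡⟨ ℚ.+-identityˡ (½ ℚ.* ε) ⟨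
      0ℚ ℚ.+ ½ ℚ.* ε                 <⟨ ℚ.+-monoˡ-< (½ ℚ.* ε) (halve ε>0) ⟩
      ½ ℚ.* ε ℚ.+ ½ ℚ.* ε            ≡⟨ halves ε ⟩
      ε                              ∎
      where open ℚ.≤-Reasoning

  Bounded : (ℕ → ℚ) → Set
  Bounded x = ∃[ B ] (0ℚ ℚ.< B) × Eventually λ n → ∣ x n ∣ ℚ.< B

  shift-bound : ∀ a b → ∣ a ℚ.- b ∣ ℚ.< 1ℚ → ∣ a ∣ ℚ.< 1ℚ ℚ.+ ∣ b ∣
  shift-bound a b q = begin-strict
    ∣ a ∣                     ≡⟨ cong ∣_∣ (solve 2 (λ a b → a := (a :- b) :+ b) refl a b) ⟩
    ∣ (a ℚ.- b) ℚ.+ b ∣       ≤⟨ ℚ.∣p+q∣≤∣p∣+∣q∣ (a ℚ.- b) b ⟩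
    ∣ a ℚ.- b ∣ ℚ.+ ∣ b ∣     <⟨ ℚ.+-monoˡ-< ∣ b ∣ q ⟩
    1ℚ ℚ.+ ∣ b ∣              ∎
    where open ℚ.≤-Reasoning

  bounded : ∀ x → Bounded (seq x)
  bounded x = go (cauchy x 1ℚ (ℚ.positive⁻¹ 1ℚ))
    where
    go : ∃[ N ] (∀ m n → N ℕ.≤ m → N ℕ.≤ n → ∣ seq x m ℚ.- seq x n ∣ ℚ.< 1ℚ) → Bounded (seq x)
    go (N , p) = 1ℚ ℚ.+ ∣ seq x N ∣
               , ℚ.+-mono-<-≤ (ℚ.positive⁻¹ 1ℚ) (ℚ.0≤∣p∣ (seq x N))
               , N , λ n n≥ → shift-bound (seq x n) (seq x N) (p n N n≥ ℕ.≤-refl)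

  Near : ℚ → (ℕ → ℚ) → ℕ → Set
  Near ε x N = ∀ m n → N ℕ.≤ m → N ℕ.≤ n → ∣ x m ℚ.- x n ∣ ℚ.< ε

  near-mono : ∀ {ε M N} x → M ℕ.≤ N → Near ε x M → Near ε x N
  near-mono x M≤N p m n m≥ n≥ = p m n (ℕ.≤-trans M≤N m≥) (ℕ.≤-trans M≤N n≥)

  const-cauchy : ∀ q → Cauchy (const q)
  const-cauchy q ε ε>0 = 0 , λ _ _ _ _ →
    ≡.subst (λ t → ∣ t ∣ ℚ.< ε) (≡.sym (ℚ.+-inverseʳ q)) ε>0

  +-cauchy : ∀ x y → Cauchy λ n → seq x n ℚ.+ seq y n
  +-cauchy x y ε ε>0 = go (cauchy x (½ ℚ.* ε) (halve ε>0)) (cauchy y (½ ℚ.* ε) (halve ε>0))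
    where
    go : ∃ (Near (½ ℚ.* ε) (seq x)) → ∃ (Near (½ ℚ.* ε) (seq y)) →
         ∃ (Near ε λ n → seq x n ℚ.+ seq y n)
    go (M , p) (N , q) = M ℕ.⊔ N , λ m n m≥ n≥ →
      +-bound {seq x m} {seq x n} {seq y m} {seq y n}
        (near-mono (seq x) (ℕ.m≤m⊔n M N) p m n m≥ n≥)
        (near-mono (seq y) (ℕ.m≤n⊔m M N) q m n m≥ n≥)

  neg-cauchy : ∀ x → Cauchy λ n → ℚ.- seq x n
  neg-cauchy x ε ε>0 = proj₁ (cauchy x ε ε>0) , λ m n m≥ n≥ →
    neg-bound (seq x m) (seq x n) (proj₂ (cauchy x ε ε>0) m n m≥ n≥)

  *-cauchy : ∀ x y → Cauchy λ n → seq x n ℚ.* seq y n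
  *-cauchy x y ε ε>0 = go (bounded x) (bounded y)
    where
    go : Bounded (seq x) → Bounded (seq y) → ∃ (Near ε λ n → seq x n ℚ.* seq y n)
    go (A , A>0 , a) (D , D>0 , d) = go′ (split (A ℚ.+ D) ε (ℚ.+-mono-< A>0 D>0) ε>0)
      where
      go′ : ∃[ δ ] (0ℚ ℚ.< δ) × ((A ℚ.+ D) ℚ.* δ ℚ.< ε) →
            ∃ (Near ε λ n → seq x n ℚ.* seq y n)
      go′ (δ , δ>0 , small) = go″ (cauchy x δ δ>0) (cauchy y δ δ>0) (a ∧ᴱ d)
        where
        go″ : ∃ (Near δ (seq x)) → ∃ (Near δ (seq y)) →
              Eventually (λ n → (∣ seq x n ∣ ℚ.< A) × (∣ seq y n ∣ ℚ.< D)) →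
              ∃ (Near ε λ n → seq x n ℚ.* seq y n)
        go″ (M , p) (N , q) (K , b) = M ℕ.⊔ N ℕ.⊔ K , λ m n m≥ n≥ → ℚ.≤-<-trans
          (*-bound {seq x m} {seq x n} {seq y m} {seq y n} A>0 D>0
            (proj₁ (b m (ℕ.≤-trans (ℕ.m≤n⊔m (M ℕ.⊔ N) K) m≥)))
            (proj₂ (b n (ℕ.≤-trans (ℕ.m≤n⊔m (M ℕ.⊔ N) K) n≥)))
            (near-mono (seq x) (ℕ.≤-trans (ℕ.m≤m⊔n M N) (ℕ.m≤m⊔n (M ℕ.⊔ N) K)) p m n m≥ n≥)
            (near-mono (seq y) (ℕ.≤-trans (ℕ.m≤n⊔m M N) (ℕ.m≤m⊔n (M ℕ.⊔ N) K)) q m n m≥ n≥))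
          small

infix  8 -ℝ_
infixl 7 _*ℝ_
infixl 6 _+ℝ_

fromℚ : ℚ → ℝ
fromℚ q .seq    = const q
fromℚ q .cauchy = const-cauchy q

0ℝ 1ℝ : ℝ
0ℝ = fromℚ 0ℚ
1ℝ = fromℚ 1ℚ

_+ℝ_ _*ℝ_ : ℝ → ℝ → ℝ
(x +ℝ y) .seq n  = seq x n ℚ.+ seq y n
(x +ℝ y) .cauchy = +-cauchy x y
(x *ℝ y) .seq n  = seq x n ℚ.* seq y n
(x *ℝ y) .cauchy = *-cauchy x y

-ℝ_ : ℝ → ℝ
(-ℝ x) .seq n  = ℚ.- seq x n
(-ℝ x) .cauchy = neg-cauchy x

private
  pointwise : ∀ {x y} → (∀ n → seq x n ≡ seq y n) → x ≈ℝ y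
  pointwise {x} {y} eq = mk≈ λ ε ε>0 → 0 , λ n _ →
    ≡.subst (λ t → ∣ t ∣ ℚ.< ε)
      (≡.sym (≡.trans (cong (ℚ._- seq y n) (eq n)) (ℚ.+-inverseʳ (seq y n)))) ε>0

  ≈ℝ-sym : ∀ {x y} → x ≈ℝ y → y ≈ℝ x
  ≈ℝ-sym {x} {y} p = mk≈ λ ε ε>0 →
    mapᴱ (λ {n} → ≡.subst (ℚ._< ε) (∣a-b∣-sym (seq x n) (seq y n))) (close p ε ε>0)

  ≈ℝ-trans : ∀ {x y z} → x ≈ℝ y → y ≈ℝ z → x ≈ℝ z
  ≈ℝ-trans {x} {y} {z} p q = mk≈ λ ε ε>0 →
    mapᴱ (λ {n} (a , b) → trans-bound {seq x n} {seq y n} {seq z n} a b)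
      (close p (½ ℚ.* ε) (halve ε>0) ∧ᴱ close q (½ ℚ.* ε) (halve ε>0))

  +ℝ-cong : ∀ {x y u v} → x ≈ℝ y → u ≈ℝ v → x +ℝ u ≈ℝ y +ℝ v
  +ℝ-cong {x} {y} {u} {v} p q = mk≈ λ ε ε>0 →
    mapᴱ (λ {n} (a , b) → +-bound {seq x n} {seq y n} {seq u n} {seq v n} a b)
      (close p (½ ℚ.* ε) (halve ε>0) ∧ᴱ close q (½ ℚ.* ε) (halve ε>0))

  -ℝ-cong : ∀ {x y} → x ≈ℝ y → -ℝ x ≈ℝ -ℝ y
  -ℝ-cong {x} {y} p = mk≈ λ ε ε>0 →
    mapᴱ (λ {n} → neg-bound (seq x n) (seq y n)) (close p ε ε>0)

  *ℝ-cong : ∀ {x y u v} → x ≈ℝ y → u ≈ℝ v → x *ℝ u ≈ℝ y *ℝ v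
  *ℝ-cong {x} {y} {u} {v} p q = mk≈ λ ε ε>0 → go ε ε>0 (bounded x) (bounded v)
    where
    go : ∀ ε → 0ℚ ℚ.< ε → Bounded (seq x) → Bounded (seq v) →
         Eventually λ n → ∣ seq x n ℚ.* seq u n ℚ.- seq y n ℚ.* seq v n ∣ ℚ.< ε
    go ε ε>0 (A , A>0 , a) (D , D>0 , d) = go′ (split (A ℚ.+ D) ε (ℚ.+-mono-< A>0 D>0) ε>0)
      where
      go′ : ∃[ δ ] (0ℚ ℚ.< δ) × ((A ℚ.+ D) ℚ.* δ ℚ.< ε) →
            Eventually λ n → ∣ seq x n ℚ.* seq u n ℚ.- seq y n ℚ.* seq v n ∣ ℚ.< ε
      go′ (δ , δ>0 , small) =
        mapᴱ (λ {n} (((a , d) , p) , q) → ℚ.≤-<-trans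
               (*-bound {seq x n} {seq y n} {seq u n} {seq v n} A>0 D>0 a d p q) small)
          (a ∧ᴱ d ∧ᴱ close p δ δ>0 ∧ᴱ close q δ δ>0)

ℝ-commutativeRing : CommutativeRing 0ℓ 0ℓ
ℝ-commutativeRing = record
  { Carrier = ℝ
  ; _≈_ = _≈ℝ_
  ; _+_ = _+ℝ_
  ; _*_ = _*ℝ_
  ; -_ = -ℝ_
  ; 0# = 0ℝ
  ; 1# = 1ℝ
  ; isCommutativeRing = record
    { isRing = record
      { +-isAbelianGroup = record
        { isGroup = record
          { isMonoid = record
            { isSemigroup = record
              { isMagma = record
                { isEquivalence = record
                  { refl = pointwise λ _ → refl ; sym = ≈ℝ-sym ; trans = ≈ℝ-trans }
                ; ∙-cong = +ℝ-cong
                }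
              ; assoc = λ x y z → pointwise λ n → ℚ.+-assoc (seq x n) (seq y n) (seq z n)
              }
            ; identity = (λ x → pointwise λ n → ℚ.+-identityˡ (seq x n))
                       , (λ x → pointwise λ n → ℚ.+-identityʳ (seq x n))
            }
          ; inverse = (λ x → pointwise λ n → ℚ.+-inverseˡ (seq x n))
                    , (λ x → pointwise λ n → ℚ.+-inverseʳ (seq x n))
          ; ⁻¹-cong = -ℝ-cong
          }
        ; comm = λ x y → pointwise λ n → ℚ.+-comm (seq x n) (seq y n)
        }
      ; *-cong = *ℝ-cong
      ; *-assoc = λ x y z → pointwise λ n → ℚ.*-assoc (seq x n) (seq y n) (seq z n)
      ; *-identity = (λ x → pointwise λ n → ℚ.*-identityˡ (seq x n))
                   , (λ x → pointwise λ n → ℚ.*-identityʳ (seq x n))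
      ; distrib = (λ x y z → pointwise λ n → ℚ.*-distribˡ-+ (seq x n) (seq y n) (seq z n))
                , (λ x y z → pointwise λ n → ℚ.*-distribʳ-+ (seq x n) (seq y n) (seq z n))
      }
    ; *-comm = λ x y → pointwise λ n → ℚ.*-comm (seq x n) (seq y n)
    }
  }

------------------------------------------------------------------------
-- Complex numbers

infix 4 _≈ℂ_ _#_

record ℂ : Set where
  no-eta-equality
  field
    re im : ℝ
open ℂ public

record _≈ℂ_ (z w : ℂ) : Set where
  constructor _,_
  field
    re≈ : re z ≈ℝ re w
    im≈ : im z ≈ℝ im w

_#_ : Rel ℂ 0ℓ
z # w = (re z #ℝ re w) ⊎ (im z #ℝ im w)

infix  8 -ℂ_
infixl 7 _*ℂ_
infixl 6 _+ℂ_

0ℂ 1ℂ : ℂ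
0ℂ .re = 0ℝ
0ℂ .im = 0ℝ
1ℂ .re = 1ℝ
1ℂ .im = 0ℝ

_+ℂ_ _*ℂ_ : ℂ → ℂ → ℂ
(z +ℂ w) .re = re z +ℝ re w
(z +ℂ w) .im = im z +ℝ im w
(z *ℂ w) .re = re z *ℝ re w +ℝ -ℝ (im z *ℝ im w)
(z *ℂ w) .im = re z *ℝ im w +ℝ im z *ℝ re w

-ℂ_ : ℂ → ℂ
(-ℂ z) .re = -ℝ re z
(-ℂ z) .im = -ℝ im z

private module R = CommutativeRing ℝ-commutativeRing
private module Laws = ComplexLaws ℝ-commutativeRing

private
  ≈ℂ-trans : ∀ {x y z} → x ≈ℂ y → y ≈ℂ z → x ≈ℂ z
  ≈ℂ-trans (p , q) (r , s) = R.trans p r , R.trans q s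

  +ℂ-cong : ∀ {x y z w} → x ≈ℂ y → z ≈ℂ w → x +ℂ z ≈ℂ y +ℂ w
  +ℂ-cong (p , q) (r , s) = R.+-cong p r , R.+-cong q s

  *ℂ-comm : ∀ x y → x *ℂ y ≈ℂ y *ℂ x
  *ℂ-comm x y =
    Laws.comm-re (re x) (im x) (re y) (im y) , Laws.comm-im (re x) (im x) (re y) (im y)

  *ℂ-identityˡ : ∀ x → 1ℂ *ℂ x ≈ℂ x
  *ℂ-identityˡ x = Laws.identity-re (re x) (im x) , Laws.identity-im (re x) (im x)

  *ℂ-distribˡ : ∀ x y z → x *ℂ (y +ℂ z) ≈ℂ x *ℂ y +ℂ x *ℂ z
  *ℂ-distribˡ x y z =
    Laws.distrib-re (re x) (im x) (re y) (im y) (re z) (im z) ,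
    Laws.distrib-im (re x) (im x) (re y) (im y) (re z) (im z)

  *ℂ-identityʳ : ∀ x → x *ℂ 1ℂ ≈ℂ x
  *ℂ-identityʳ x = ≈ℂ-trans (*ℂ-comm x 1ℂ) (*ℂ-identityˡ x)

  *ℂ-distribʳ : ∀ x y z → (y +ℂ z) *ℂ x ≈ℂ y *ℂ x +ℂ z *ℂ x
  *ℂ-distribʳ x y z = ≈ℂ-trans (*ℂ-comm (y +ℂ z) x)
    (≈ℂ-trans (*ℂ-distribˡ x y z) (+ℂ-cong (*ℂ-comm x y) (*ℂ-comm x z)))

ℂ-commutativeRing : CommutativeRing 0ℓ 0ℓ
ℂ-commutativeRing = record
  { Carrier = ℂ
  ; _≈_ = _≈ℂ_
  ; _+_ = _+ℂ_
  ; _*_ = _*ℂ_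
  ; -_ = -ℂ_
  ; 0# = 0ℂ
  ; 1# = 1ℂ
  ; isCommutativeRing = record
    { isRing = record
      { +-isAbelianGroup = record
        { isGroup = record
          { isMonoid = record
            { isSemigroup = record
              { isMagma = record
                { isEquivalence = record
                  { refl = R.refl , R.refl
                  ; sym = λ (p , q) → R.sym p , R.sym q
                  ; trans = ≈ℂ-trans
                  }
                ; ∙-cong = +ℂ-cong
                }
              ; assoc = λ x y z → R.+-assoc (re x) (re y) (re z) , R.+-assoc (im x) (im y) (im z)
              }
            ; identity = (λ x → R.+-identityˡ (re x) , R.+-identityˡ (im x))
                       , (λ x → R.+-identityʳ (re x) , R.+-identityʳ (im x))
            }
          ; inverse = (λ x → R.-‿inverseˡ (re x) , R.-‿inverseˡ (im x))
                    , (λ x → R.-‿inverseʳ (re x) , R.-‿inverseʳ (im x))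
          ; ⁻¹-cong = λ (p , q) → R.-‿cong p , R.-‿cong q
          }
        ; comm = λ x y → R.+-comm (re x) (re y) , R.+-comm (im x) (im y)
        }
      ; *-cong = λ (p , q) (r , s) →
          R.+-cong (R.*-cong p r) (R.-‿cong (R.*-cong q s)) ,
          R.+-cong (R.*-cong p s) (R.*-cong q r)
      ; *-assoc = λ x y z →
          Laws.assoc-re (re x) (im x) (re y) (im y) (re z) (im z) ,
          Laws.assoc-im (re x) (im x) (re y) (im y) (re z) (im z)
      ; *-identity = *ℂ-identityˡ , *ℂ-identityʳ
      ; distrib = *ℂ-distribˡ , *ℂ-distribʳ
      }
    ; *-comm = *ℂ-comm
    }
  }

open CommutativeRing ℂ-commutativeRing using (semiring; _≈_; _+_; _*_; 0#; 1#; _-_) public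
open SemiringSum semiring using (sum) public

fromℝ : ℝ → ℂ
fromℝ x .re = x
fromℝ x .im = 0ℝ

fromℕ : ℕ → ℂ
fromℕ n = fromℝ (fromℚ (+ n ℚ./ 1))

------------------------------------------------------------------------
-- Complex matrices

Matrix : ℕ → ℕ → Set
Matrix m n = Vector (Vector ℂ n) m

infix  4 _≈ᵛ_ _≈ᴹ_
infixl 6 _+ᴹ_ _-ᴹ_
infixl 7 _*ᴹ_ _*ᵛ_ _·ᴹ_

_≈ᵛ_ : Rel (Vector ℂ n) 0ℓ
v ≈ᵛ w = ∀ a → v a ≈ w a

_≈ᴹ_ : Rel (Matrix m n) 0ℓ
A ≈ᴹ B = ∀ a b → A a b ≈ B a b

0ᵛ : Vector ℂ n
0ᵛ _ = 0#

0ᴹ : Matrix m n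
0ᴹ _ _ = 0#

1ᴹ : Matrix n n
1ᴹ a b with a Fin.≟ b
... | yes _ = 1#
... | no  _ = 0#

_+ᴹ_ _-ᴹ_ : Matrix m n → Matrix m n → Matrix m n
(A +ᴹ B) a b = A a b + B a b
(A -ᴹ B) a b = A a b - B a b

_·ᴹ_ : ℂ → Matrix m n → Matrix m n
(z ·ᴹ A) a b = z * A a b

_*ᴹ_ : Matrix m n → Matrix n k → Matrix m k
(A *ᴹ B) a b = sum λ r → A a r * B r b

_*ᵛ_ : Matrix m n → Vector ℂ n → Vector ℂ m
(A *ᵛ v) a = sum λ r → A a r * v r

replaceColumn : Matrix m n → Fin n → Vector ℂ m → Matrix m n
replaceColumn A k v = transpose (updateAt (transpose A) k (const v))

*ᴹ-rawMonoid : ℕ → RawMonoid 0ℓ 0ℓ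
*ᴹ-rawMonoid n = record { Carrier = Matrix n n ; _≈_ = _≈ᴹ_ ; _∙_ = _*ᴹ_ ; ε = 1ᴹ }

-- Being nonzero is read positively: some entry is apart from 0.

NonZeroᵛ : Pred (Vector ℂ n) 0ℓ
NonZeroᵛ v = ∃[ a ] v a # 0#

NonZeroᴹ : Pred (Matrix m n) 0ℓ
NonZeroᴹ A = ∃[ a ] ∃[ b ] A a b # 0#

combination : Vector ℂ m → Vector (Vector ℂ n) m → Vector ℂ n
combination c v a = sum λ j → c j * v j a

record IsBasis (v : Vector (Vector ℂ n) n) : Set where
  field
    independent : ∀ c → combination c v ≈ᵛ 0ᵛ → c ≈ᵛ 0ᵛ
    spanning    : ∀ w → ∃[ c ] w ≈ᵛ combination c v

record IsEigenvector (A : Matrix n n) (v : Vector ℂ n) (ν : ℂ) : Set where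
  field
    nonZero  : NonZeroᵛ v
    equation : A *ᵛ v ≈ᵛ λ a → ν * v a

record IsEigenbasis (A : Matrix n n) (v : Vector (Vector ℂ n) n) (ν : Vector ℂ n) : Set where
  field
    isBasis       : IsBasis v
    isEigenvector : ∀ j → IsEigenvector A (v j) (ν j)

record IsSubspace (W : Pred (Vector ℂ n) 0ℓ) : Set where
  field
    resp  : W Respects _≈ᵛ_
    zeroᵂ : W 0ᵛ
    add   : ∀ {v w} → W v → W w → W (λ a → v a + w a)
    scale : ∀ z {v} → W v → W (λ a → z * v a)

------------------------------------------------------------------------
-- Finite groups

record FiniteGroup c ℓ : Set (lsuc (c ⊔ ℓ)) where
  field
    group       : Group c ℓ
    order       : ℕ
    enumeration : Inverse (Group.setoid group) (≡.setoid (Fin order))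
  open Group group public using (Carrier; rawMonoid; _⁻¹) renaming (_≈_ to _≈ᴳ_)

module _ (G : FiniteGroup c ℓ) where
  open FiniteGroup G

  -- Membership is decidable, as the characteristic function of S must exist.
  record SymmetricSubset p : Set (c ⊔ ℓ ⊔ lsuc p) where
    field
      _∈S  : Pred Carrier p
      _∈S? : Decidable _∈S
      resp : _∈S Respects _≈ᴳ_
      symm : ∀ {g} → g ∈S → (g ⁻¹) ∈S

    elements : List Carrier
    elements = filter _∈S? (List.map (Inverse.from enumeration) (allFin order))

    size : ℕ
    size = List.length elements

  -- The matrices of a representation are automatically invertible, G being a group.
  record Representation (n : ℕ) : Set (c ⊔ ℓ) where
    field
      ρ              : Carrier → Matrix n n
      isHomomorphism : IsMonoidHomomorphism rawMonoid (*ᴹ-rawMonoid n) ρ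

module _ {G : FiniteGroup c ℓ} where
  open FiniteGroup G
  open Representation

  -- Invertible intertwiner P, with inverse Q.
  _≅_ : Representation G m → Representation G n → Set c
  σ ≅ τ = ∃[ P ] ∃[ Q ] (P *ᴹ Q ≈ᴹ 1ᴹ) × (Q *ᴹ P ≈ᴹ 1ᴹ) ×
          (∀ g → P *ᴹ ρ σ g ≈ᴹ ρ τ g *ᴹ P)

  IsInvariant : Representation G n → Pred (Vector ℂ n) 0ℓ → Set c
  IsInvariant σ W = ∀ g {v} → W v → W (ρ σ g *ᵛ v)

  -- Classically, "every nonzero invariant subspace is everything" says that the only
  -- invariant subspaces are 0 and the whole space. The disjunctive form would be
  -- constructively unprovable even in dimension 1.
  record IsIrreducible (σ : Representation G n) : Set (c ⊔ lsuc 0ℓ) where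
    field
      positive : 0 ℕ.< n
      simple   : ∀ W → IsSubspace W → IsInvariant σ W →
                 (∃[ v ] W v × NonZeroᵛ v) → ∀ w → W w

-- A maximal set ρ₁, …, ρ_L of inequivalent irreducible representations.
record Dual (G : FiniteGroup c ℓ) : Set (c ⊔ ℓ ⊔ lsuc 0ℓ) where
  field
    L            : ℕ
    dim          : Fin L → ℕ
    rep          : ∀ i → Representation G (dim i)
    irreducible  : ∀ i → IsIrreducible (rep i)
    inequivalent : ∀ {i j} → i ≢ j → ¬ (rep i ≅ rep j)
    maximal      : ∀ {n} (σ : Representation G n) → IsIrreducible σ → ∃[ i ] σ ≅ rep i

------------------------------------------------------------------------
-- The diffusion operator on the Fourier side

module Diffusion {G : FiniteGroup c ℓ} (S : SymmetricSubset G p) (Ĝ : Dual G) where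
  open FiniteGroup G using (Carrier)
  open SymmetricSubset S using (elements; size)
  open Dual Ĝ

  ∑S : (Carrier → Matrix m n) → Matrix m n
  ∑S A = foldr (λ g B → A g +ᴹ B) 0ᴹ elements

  MatrixFunction : Set
  MatrixFunction = ∀ i → Matrix (dim i) (dim i)

  ρ⟨_⟩ : ∀ i → Carrier → Matrix (dim i) (dim i)
  ρ⟨ i ⟩ = Representation.ρ (rep i)

  M : MatrixFunction
  M i = ∑S ρ⟨ i ⟩

  ∣S∣+ : ℝ → ℂ
  ∣S∣+ α₀ = fromℕ size + fromℝ α₀

  -- The Fourier transform of the operator f ↦ ((|S| + α₀) χₑ − χ_S) * f on functions G → ℂ.
  Ĥ₀ : ℝ → MatrixFunction → MatrixFunction
  Ĥ₀ α₀ F i = (∣S∣+ α₀ ·ᴹ F i) -ᴹ ∑S (λ g → ρ⟨ i ⟩ g *ᴹ F i)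

  record IsEigenfunction (T : MatrixFunction → MatrixFunction)
                         (F : MatrixFunction) (μ : ℂ) : Set where
    field
      nonZero  : ∃[ i ] NonZeroᴹ (F i)
      equation : ∀ i → T F i ≈ᴹ μ ·ᴹ F i

  -- The matrix A at ρᵢ, and 0 at every other representation.
  supportedAt : ∀ i → Matrix (dim i) (dim i) → MatrixFunction
  supportedAt i A i′ with i Fin.≟ i′
  ... | yes refl = A
  ... | no  _    = 0ᴹ

  -- fⁱⱼₖ is f i vⁱⱼ k.
  f : ∀ i → Vector ℂ (dim i) → Fin (dim i) → MatrixFunction
  f i v k = supportedAt i (replaceColumn 0ᴹ k v)

{-# OPTIONS --safe #-}
module Submission where

-- Right multiplication by F(ρ) is linear, so Ĥ₀[F](ρ) = (|S| + α₀) F(ρ) − M(ρ) F(ρ), and it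
-- suffices that M(ρ) F(ρ) = ν F(ρ) for every ρ. As M(ρ) acts columnwise, this only needs
-- checking on columns, each of which is either the eigenvector or 0.

open import Defs
open import Algebra.Bundles using (CommutativeRing)
import Algebra.Properties.Ring as RingProperties
import Algebra.Properties.Semiring.Sum as SemiringSum
open import Data.Fin.Base using (Fin; zero; suc)
import Data.Fin.Properties as Fin
open import Data.List.Base using (List; []; _∷_; foldr)
open import Data.Nat.Base using (ℕ)
open import Data.Product.Base using (_,_)
open import Data.Vec.Functional using (Vector; transpose; updateAt)
open import Data.Vec.Functional.Properties using (updateAt-updates)
open import Function.Base using (const)
open import Level using (Level)
open import Relation.Binary.PropositionalEquality as ≡ using (_≡_; refl)
open import Relation.Nullary.Decidable using (yes; no)
open import Relation.Unary using (Pred)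

open CommutativeRing ℂ-commutativeRing
  using (setoid; ring; sym; trans; +-congˡ; -‿cong; zeroˡ; zeroʳ; distribʳ)
open RingProperties ring using ([y-z]x≈yx-zx)
open SemiringSum semiring using (sum-cong-≋; sum-replicate-zero; ∑-distrib-+)
open import Relation.Binary.Reasoning.Setoid setoid

private variable
  a p : Level
  m n k : ℕ

-- Induction on the index follows the recursion of `updateAt`, so no equality of indices has to be
-- decided.
updateAt-all : {A : Set a} (P : Pred A p) {xs : Vector A n} (i : Fin n) {g : A → A} →
               P (g (xs i)) → (∀ j → P (xs j)) → ∀ j → P (updateAt xs i g j)
updateAt-all P zero    px pxs zero    = px
updateAt-all P zero    px pxs (suc j) = pxs (suc j)
updateAt-all P (suc i) px pxs zero    = pxs zero
updateAt-all P (suc i) px pxs (suc j) = updateAt-all P i px (λ j → pxs (suc j)) j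

*ᵛ-zeroʳ : (A : Matrix m n) → A *ᵛ 0ᵛ ≈ᵛ 0ᵛ
*ᵛ-zeroʳ {n = n} A a = trans (sum-cong-≋ λ r → zeroʳ (A a r)) (sum-replicate-zero n)

*ᴹ-zeroˡ : (B : Matrix n k) → 0ᴹ {m} *ᴹ B ≈ᴹ 0ᴹ
*ᴹ-zeroˡ {n = n} B a b = trans (sum-cong-≋ λ r → zeroˡ (B r b)) (sum-replicate-zero n)

*ᴹ-distribʳ : (C : Matrix n k) (A B : Matrix m n) → (A +ᴹ B) *ᴹ C ≈ᴹ (A *ᴹ C) +ᴹ (B *ᴹ C)
*ᴹ-distribʳ C A B a b = trans (sum-cong-≋ λ r → distribʳ (C r b) (A a r) (B a r))
  (∑-distrib-+ (λ r → A a r * C r b) (λ r → B a r * C r b))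

-- Stated for an arbitrary list to permit induction; the two folds are the unfolded form of `∑S`.
sumᴹ-*ᴹ : {X : Set a} (A : X → Matrix m n) (B : Matrix n k) (xs : List X) →
          foldr (λ x C → (A x *ᴹ B) +ᴹ C) 0ᴹ xs ≈ᴹ foldr (λ x C → A x +ᴹ C) 0ᴹ xs *ᴹ B
sumᴹ-*ᴹ A B []       a b = sym (*ᴹ-zeroˡ B a b)
sumᴹ-*ᴹ A B (x ∷ xs) a b =
  trans (+-congˡ (sumᴹ-*ᴹ A B xs a b)) (sym (*ᴹ-distribʳ B (A x) (foldr (λ x C → A x +ᴹ C) 0ᴹ xs) a b))

-- By computation, entry `a b` of each side depends only on column `b`, and `replaceColumn` is
-- `updateAt` on the transpose. So `updateAt-all` applies, with the eigenvector equation as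
-- predicate; the zero columns satisfy it trivially.
*ᴹ-replaceColumn : {A : Matrix n n} {v : Vector ℂ n} {ν : ℂ} (k : Fin n) →
                   A *ᵛ v ≈ᵛ (λ a → ν * v a) →
                   A *ᴹ replaceColumn 0ᴹ k v ≈ᴹ ν ·ᴹ replaceColumn 0ᴹ k v
*ᴹ-replaceColumn {A = A} {v} {ν} k eq a b =
  updateAt-all (λ w → A *ᵛ w ≈ᵛ λ a → ν * w a) k eq
    (λ _ a → trans (*ᵛ-zeroʳ A a) (sym (zeroʳ ν))) b a

replaceColumn-nonZero : (A : Matrix m n) (k : Fin n) {v : Vector ℂ m} →
                        NonZeroᵛ v → NonZeroᴹ (replaceColumn A k v)
replaceColumn-nonZero A k {v} (a , v#0) =
  a , k , ≡.subst (λ w → w a # 0#)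
            (≡.sym (updateAt-updates k {const v} (transpose A))) v#0

module _ {c ℓ p} {G : FiniteGroup c ℓ} (S : SymmetricSubset G p) (Ĝ : Dual G) where
  open SymmetricSubset S using (elements)
  open Dual Ĝ
  open Diffusion S Ĝ

  -- The predicate varies with the representation because the size of the matrix does; matching on
  -- `refl` identifies the two sizes.
  supportedAt-all : ∀ {q} (P : ∀ i → Pred (Matrix (dim i) (dim i)) q) {i A} →
                    P i A → (∀ i′ → P i′ 0ᴹ) → ∀ i′ → P i′ (supportedAt i A i′)
  supportedAt-all P {i} pA p0 i′ with i Fin.≟ i′
  ... | yes refl = pA
  ... | no  _    = p0 i′

  -- For a variable `i` the test `i Fin.≟ i` does not reduce; rewriting it to `yes refl` lets
  -- `supportedAt` compute.
  supportedAt-self : ∀ i A → supportedAt i A i ≡ A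
  supportedAt-self i A rewrite ≡.≡-≟-identity Fin._≟_ (refl {x = i}) = refl

  Ĥ₀-eigen : ∀ α₀ F ν i → M i *ᴹ F i ≈ᴹ ν ·ᴹ F i →
             Ĥ₀ α₀ F i ≈ᴹ (∣S∣+ α₀ - ν) ·ᴹ F i
  Ĥ₀-eigen α₀ F ν i eq a b = begin
    ∣S∣+ α₀ * F i a b - ∑S (λ g → ρ⟨ i ⟩ g *ᴹ F i) a b
      -- `F i` is pulled out of the sum on the right, leaving `M i *ᴹ F i`, to which `eq` applies.
      ≈⟨ +-congˡ (-‿cong (trans (sumᴹ-*ᴹ ρ⟨ i ⟩ (F i) elements a b) (eq a b))) ⟩
    ∣S∣+ α₀ * F i a b - ν * F i a b
      ≈⟨ [y-z]x≈yx-zx (F i a b) (∣S∣+ α₀) ν ⟨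
    (∣S∣+ α₀ - ν) * F i a b ∎

proposition10 : ∀ {c ℓ p} (G : FiniteGroup c ℓ) (S : SymmetricSubset G p)
    (α₀ : ℝ) → 0ℝ <ℝ α₀ →
    (Ĝ : Dual G) →
    let open Dual Ĝ
        open Diffusion S Ĝ
    in
    (v : ∀ i → Vector (Vector ℂ (dim i)) (dim i))
    (ν : ∀ i → Vector ℂ (dim i)) →
    (∀ i → IsEigenbasis (M i) (v i) (ν i)) →
    ∀ (i : Fin L) (j k : Fin (dim i)) →
    IsEigenfunction (Ĥ₀ α₀) (f i (v i j) k) (∣S∣+ α₀ - ν i j)
proposition10 G S α₀ _ Ĝ v ν eigenbasis i j k = record
  { nonZero  = i , ≡.subst NonZeroᴹ (≡.sym (supportedAt-self S Ĝ i _))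
                     (replaceColumn-nonZero 0ᴹ k nonZero)
  ; equation = λ i′ → Ĥ₀-eigen S Ĝ α₀ (f i (v i j) k) (ν i j) i′
      (supportedAt-all S Ĝ (λ i′ A → M i′ *ᴹ A ≈ᴹ ν i j ·ᴹ A)
        (*ᴹ-replaceColumn k equation)
        -- Away from `i` the matrix is zero, so the equation holds with any scalar, in particular
        -- `ν i j`. Each column of `0ᴹ` is `0ᵛ` by computation.
        (λ i′ a _ → trans (*ᵛ-zeroʳ (M i′) a) (sym (zeroʳ _))) i′)
  }
  where
  open Diffusion S Ĝ using (M; f)
  open IsEigenvector (IsEigenbasis.isEigenvector (eigenbasis i) j)
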